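{- Let $n$ be a positive integer and let $A(n)=(a_{ij})$, $p=p(n)$, $pp=pp(n)$, $b(n)$, $l_{max}$ be as in the context. Let $m\ge 1$ be an integer such that $\overline{p}=pm$ satisfies $\lfloor \overline{p}/2\rfloor> b(n)$ and $\overline{p}\ge 2\,l_{max}$, put $r=\lfloor\overline{p}/2\rfloor$, let $v$ be an integer with $v\ge pp+\overline{p}$, and let $B=(b_{ij})_{1\le i,j\le\overline{p}}$ be the $\overline{p}\times\overline{p}$ matrix with $b_{ij}=a_{v+i,v+j}$ if $i-r\le j\le i+r$; $b_{ij}=a_{v+i,v+j-\overline{p}}$ if $j>i+r$; $b_{ij}=a_{v+i,v+j+\overline{p}}$ if $j<i-r$. Consider the incidence structure whose points are the columns of $B$ and whose lines are the rows of $B$, where column $i$ is incident with row $j$ iff $b_{ji}=1$. Then any two distinct lines are incident with at most one common point; equivalently, there are no indices $1\le i<j\le\overline{p}$, $1\le k<l\le\overline{p}$ with $b_{ik}=b_{il}=b_{jk}=b_{jl}=1$.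
   Context: $\mathbb{N}=\{1,2,3,\dots\}$. Fix a positive integer $n$. The infinite $\{0,1\}$-matrix $A(n)=(a_{ij})_{i,j\in\mathbb{N}}$ is defined recursively. Its entries are determined row by row (row $1$ first), and within each row from left to right, so that $a_{kl}$ is determined after all $a_{ij}$ with $i<k$ and all $a_{kj}$ with $j<l$. One sets $a_{kl}=1$ if and only if all of the following hold: (1) $\sum_{j<l}a_{kj}<n+1$; (2) $\sum_{i<k}a_{il}<n+1$; (3) there is no pair $(i,j)$ with $1\le i<k$, $1\le j<l$ and $a_{ij}=a_{il}=a_{kj}=1$. Otherwise $a_{kl}=0$. The matrix $A(n)$ is eventually periodic along the diagonal: there exist $c\ge0$, $q\ge1$ with $a_{i+q,j+q}=a_{ij}$ for all $i>c$, $j\ge1$. The period $p=p(n)$ is the smallest $q\ge1$ for which such a $c$ exists, and the preperiod $pp=pp(n)$ is the smallest $c\ge 0$ with $a_{i+p,j+p}=a_{ij}$ for all $i>c$, $j\ge 1$. Define $b(n)=\max\{|j-i| : i,j\ge1,\ a_{ij}=1,\ i>pp(n)\}$. The length of a row $k$ of $A(n)$ (which contains finitely many and at least one ones) is $l-f+1$, where $f$ and $l$ are the smallest and largest $j$ with $a_{kj}=1$; $l_{max}$ is the maximum length of a row $k$ of $A(n)$ with $k>pp(n)$. -}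

module Defs where

open import Data.Bool using (if_then_else_)
open import Data.Fin as Fin using (Fin; toℕ)
open import Data.List using (applyUpTo)
open import Data.Nat using (ℕ; zero; suc; pred; _+_; _∸_; _≤_; _<_; z≤n; s≤s; s<s; s≤s⁻¹; ∣_-_∣; ⌊_/2⌋)
open import Data.Nat.ListAction using (sum)
open import Data.Nat.Properties using (_≟_; _≤?_; _<?_; anyUpTo?; <⇒≢; m≤n⇒m<n∨m≡n)
open import Data.Product using (∃-syntax; _×_; _,_)
open import Data.Sum using (inj₁; inj₂)
open import Function using (_∘_; _⇔_; mk⇔)
open import Level using (Level)
open import Relation.Binary.PropositionalEquality using (_≡_; _≢_; refl; sym; trans; cong₂; subst)
open import Relation.Nullary using (¬_; Dec; yes; no; does; _×-dec_; ¬?; contradiction)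
open import Relation.Unary using (Pred)

-- Infinite matrices are indexed by {1,2,3,…} as in the source; values at
-- index 0 are junk and affect none of the notions below.
Matrix : Set
Matrix = ℕ → ℕ → ℕ

-- Σ_{1 ≤ j < l} f j
sumBelow : (ℕ → ℕ) → ℕ → ℕ
sumBelow f l = sum (applyUpTo (f ∘ suc) (pred l))

CompletesRectangle : Matrix → ℕ → ℕ → Set
CompletesRectangle a k l =
  ∃[ i ] i < k × 1 ≤ i × ∃[ j ] j < l × 1 ≤ j × a i j ≡ 1 × a i l ≡ 1 × a k j ≡ 1

Admissible : ℕ → Matrix → ℕ → ℕ → Set
Admissible n a k l =
    sumBelow (λ j → a k j) l < n + 1
  × sumBelow (λ i → a i l) k < n + 1
  × ¬ CompletesRectangle a k l

admissible? : ∀ n a k l → Dec (Admissible n a k l)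
admissible? n a k l =
        (sumBelow (λ j → a k j) l <? n + 1)
  ×-dec (sumBelow (λ i → a i l) k <? n + 1)
  ×-dec ¬? (anyUpTo? (λ i → (1 ≤? i) ×-dec
              anyUpTo? (λ j → (1 ≤? j) ×-dec (a i j ≟ 1) ×-dec (a i l ≟ 1) ×-dec (a k j ≟ 1)) l) k)

setEntry : Matrix → ℕ → ℕ → ℕ → Matrix
setEntry a k l x i j = if does ((i ≟ k) ×-dec (j ≟ l)) then x else a i j

-- Entries (k,1), …, (k,l) are determined in this order, starting from a
-- matrix in which the rows above k are already final.
fillRow : ℕ → Matrix → ℕ → ℕ → Matrix
fillRow n a k zero    = a
fillRow n a k (suc l) =
  let a′ = fillRow n a k l in
  setEntry a′ k (suc l) (if does (admissible? n a′ k (suc l)) then 1 else 0)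

-- Rows 1, …, k are final; everything else is 0.
fillRows : ℕ → ℕ → Matrix
fillRows n zero    i j = 0
fillRows n (suc k) i j = fillRow n (fillRows n k) (suc k) j i j

A : ℕ → Matrix
A n k l = fillRows n k k l

IsLeast IsGreatest : ∀ {ℓ : Level} → Pred ℕ ℓ → Pred ℕ ℓ
IsLeast    P x = P x × (∀ y → P y → x ≤ y)
IsGreatest P x = P x × (∀ y → P y → y ≤ x)

PeriodicFrom : Matrix → ℕ → ℕ → Set
PeriodicFrom a q c = ∀ i j → c < i → 1 ≤ j → a (i + q) (j + q) ≡ a i j

IsPeriod : Matrix → ℕ → Set
IsPeriod a = IsLeast (λ q → 1 ≤ q × ∃[ c ] PeriodicFrom a q c)

IsPreperiod : Matrix → ℕ → ℕ → Set
IsPreperiod a p = IsLeast (PeriodicFrom a p)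

-- The number b(n), for a = A n and pp = pp(n).
IsBandwidth : Matrix → ℕ → ℕ → Set
IsBandwidth a pp =
  IsGreatest (λ d → ∃[ i ] ∃[ j ] 1 ≤ i × 1 ≤ j × a i j ≡ 1 × pp < i × d ≡ ∣ j - i ∣)

IsRowLength : Matrix → ℕ → ℕ → Set
IsRowLength a k len =
  ∃[ f ] ∃[ l ] IsLeast    (λ j → 1 ≤ j × a k j ≡ 1) f
              × IsGreatest (λ j → 1 ≤ j × a k j ≡ 1) l
              × len ≡ l ∸ f + 1

IsMaxRowLength : Matrix → ℕ → ℕ → Set
IsMaxRowLength a pp = IsGreatest (λ len → ∃[ k ] pp < k × IsRowLength a k len)

-- The matrix B for 1-based indices i, j ≤ p̄.  The test i - r ≤ j is written
-- i ≤ j + r; the subtraction of p̄ is not truncated as long as p̄ ≤ v.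
wrap : Matrix → (p̄ v : ℕ) → Matrix
wrap a p̄ v i j =
  let r = ⌊ p̄ /2⌋ in
  if does ((i ≤? j + r) ×-dec (j ≤? i + r)) then a (v + i) (v + j)
  else if does (i + r <? j)                 then a (v + i) (v + j ∸ p̄)
  else                                           a (v + i) (v + j + p̄)

-- Element i of Fin p̄ stands for the index toℕ i + 1.
B : Matrix → (p̄ v : ℕ) → Fin p̄ → Fin p̄ → ℕ
B a p̄ v i j = wrap a p̄ v (suc (toℕ i)) (suc (toℕ j))

record IncidenceStructure : Set₁ where
  field
    Point Line : Set
    _I_        : Point → Line → Set

incidenceStructure : ∀ {s} → (Fin s → Fin s → ℕ) → IncidenceStructure
incidenceStructure {s} b = record
  { Point = Fin s
  ; Line  = Fin s
  ; _I_   = λ i j → b j i ≡ 1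
  }

LinesMeetAtMostOnce : IncidenceStructure → Set
LinesMeetAtMostOnce S =
  ∀ (g h : Line) → g ≢ h → ∀ (x y : Point) → x I g → x I h → y I g → y I h → x ≡ y
  where open IncidenceStructure S

NoRectangle : ∀ {s} → (Fin s → Fin s → ℕ) → Set
NoRectangle {s} b =
  ¬ (∃[ i ] ∃[ j ] ∃[ k ] ∃[ l ] i Fin.< j × k Fin.< l
       × b i k ≡ 1 × b i l ≡ 1 × b j k ≡ 1 × b j l ≡ 1)

-- A n satisfies (and, by recursion, is determined on positive indices by)
-- the defining rule of the source: see A-one and A-zero.

private
  if-yes : ∀ {P : Set} (P? : Dec P) {x y : ℕ} → P → (if does P? then x else y) ≡ x
  if-yes (yes _) p = refl
  if-yes (no ¬p) p = contradiction p ¬p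

  if-no : ∀ {P : Set} (P? : Dec P) {x y : ℕ} → ¬ P → (if does P? then x else y) ≡ y
  if-no (yes p) ¬p = contradiction p ¬p
  if-no (no _)  ¬p = refl

  if-one : ∀ {P : Set} (P? : Dec P) → (if does P? then 1 else 0) ≡ 1 → P
  if-one (yes p) _ = p

  setEntry-same : ∀ a k l x → setEntry a k l x k l ≡ x
  setEntry-same a k l x = if-yes ((k ≟ k) ×-dec (l ≟ l)) (refl , refl)

  setEntry-other : ∀ a k l x i j → ¬ (i ≡ k × j ≡ l) → setEntry a k l x i j ≡ a i j
  setEntry-other a k l x i j = if-no ((i ≟ k) ×-dec (j ≟ l))

  fillRow-other : ∀ n a k l i j → i ≢ k → fillRow n a k l i j ≡ a i j
  fillRow-other n a k zero    i j i≢k = refl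
  fillRow-other n a k (suc l) i j i≢k =
    trans (setEntry-other (fillRow n a k l) k (suc l) _ i j λ (i≡k , _) → i≢k i≡k)
          (fillRow-other n a k l i j i≢k)

  fillRow-stable : ∀ n a k l j → j ≤ l → fillRow n a k l k j ≡ fillRow n a k j k j
  fillRow-stable n a k zero    zero j≤l = refl
  fillRow-stable n a k (suc l) j j≤l with m≤n⇒m<n∨m≡n j≤l
  ... | inj₂ refl = refl
  ... | inj₁ j<l  =
    trans (setEntry-other (fillRow n a k l) k (suc l) _ k j λ (_ , j≡l) → <⇒≢ j<l j≡l)
          (fillRow-stable n a k l j (s≤s⁻¹ j<l))

  fillRows-stable : ∀ n k i j → i ≤ k → fillRows n k i j ≡ A n i j
  fillRows-stable n zero    zero j i≤k = refl
  fillRows-stable n (suc k) i    j i≤k with m≤n⇒m<n∨m≡n i≤k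
  ... | inj₂ refl = refl
  ... | inj₁ i<k  =
    trans (fillRow-other n (fillRows n k) (suc k) j i j (<⇒≢ i<k))
          (fillRows-stable n k i j (s≤s⁻¹ i<k))

  sum-cong : ∀ {f g} m → (∀ x → x < m → f x ≡ g x) → sum (applyUpTo f m) ≡ sum (applyUpTo g m)
  sum-cong zero    f≗g = refl
  sum-cong (suc m) f≗g =
    cong₂ _+_ (f≗g 0 (s≤s z≤n)) (sum-cong m λ x x<m → f≗g (suc x) (s<s x<m))

  Admissible-cong : ∀ n a b k l →
    (∀ i j → i < suc k → a i j ≡ b i j) →
    (∀ j → j < suc l → a (suc k) j ≡ b (suc k) j) →
    Admissible n a (suc k) (suc l) → Admissible n b (suc k) (suc l)
  Admissible-cong n a b k l above left (row , col , rect) =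
      subst (_< n + 1) (sum-cong l λ j j<l → left (suc j) (s<s j<l)) row
    , subst (_< n + 1) (sum-cong k λ i i<k → above (suc i) (suc l) (s<s i<k)) col
    , λ (i , i<k , 1≤i , j , j<l , 1≤j , ij , il , kj) →
        rect (i , i<k , 1≤i , j , j<l , 1≤j
             , trans (above i j i<k) ij , trans (above i (suc l) i<k) il , trans (left j j<l) kj)

  before : ℕ → ℕ → ℕ → Matrix
  before n k l = fillRow n (fillRows n k) (suc k) l

  A-step : ∀ n k l →
    A n (suc k) (suc l) ≡ (if does (admissible? n (before n k l) (suc k) (suc l)) then 1 else 0)
  A-step n k l = setEntry-same (before n k l) (suc k) (suc l) _

  before-above : ∀ n k l i j → i < suc k → before n k l i j ≡ A n i j
  before-above n k l i j i<k =
    trans (fillRow-other n _ (suc k) l i j (<⇒≢ i<k)) (fillRows-stable n k i j (s≤s⁻¹ i<k))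

  before-left : ∀ n k l j → j < suc l → before n k l (suc k) j ≡ A n (suc k) j
  before-left n k l j j<l = fillRow-stable n _ (suc k) l j (s≤s⁻¹ j<l)

  before⇒A : ∀ n k l →
    Admissible n (before n k l) (suc k) (suc l) → Admissible n (A n) (suc k) (suc l)
  before⇒A n k l = Admissible-cong n _ _ k l (before-above n k l) (before-left n k l)

  A⇒before : ∀ n k l →
    Admissible n (A n) (suc k) (suc l) → Admissible n (before n k l) (suc k) (suc l)
  A⇒before n k l = Admissible-cong n _ _ k l
    (λ i j i<k → sym (before-above n k l i j i<k)) (λ j j<l → sym (before-left n k l j j<l))

A-one : ∀ n k l → 1 ≤ k → 1 ≤ l → A n k l ≡ 1 ⇔ Admissible n (A n) k l
A-one n (suc k) (suc l) _ _ = mk⇔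
  (λ A≡1 → before⇒A n k l (if-one adm? (trans (sym (A-step n k l)) A≡1)))
  (λ adm → trans (A-step n k l) (if-yes adm? (A⇒before n k l adm)))
  where adm? = admissible? n (before n k l) (suc k) (suc l)

A-zero : ∀ n k l → 1 ≤ k → 1 ≤ l → ¬ Admissible n (A n) k l → A n k l ≡ 0
A-zero n (suc k) (suc l) _ _ ¬adm =
  trans (A-step n k l)
        (if-no (admissible? n (before n k l) (suc k) (suc l)) (¬adm ∘ before⇒A n k l))

{-# OPTIONS --safe #-}
-- Lift a rectangle in B to A(n): a one of B in row i and column k comes from a
-- one of A(n) in row v+i, in a column congruent to v+k modulo p̄.  Two ones of
-- a row of A(n) are less than p̄/2 apart, so the two rows of the rectangle
-- have the same column distance not only modulo p̄ but exactly.  Hence the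
-- second row is, in its two columns, the first one shifted by a multiple of p̄,
-- and the bandwidth bound only leaves the multiples 0 and p̄.  Shifting the
-- first row along the diagonal by 0 or p̄ thus gives a rectangle in A(n), which
-- the greedy rule forbids.
module Submission where

open import Defs
open import Data.Bool using (true; false)
open import Data.Fin using (Fin; toℕ)
open import Data.Fin.Properties using (toℕ-injective; toℕ<n)
open import Data.Nat using (ℕ; zero; suc; _+_; _*_; _∸_; _≤_; _<_; _≥_; _>_; ⌊_/2⌋; ⌈_/2⌉; ∣_-_∣; s≤s; z≤n; s≤s⁻¹)
open import Data.Nat.Properties
open import Data.Nat.Tactic.RingSolver using (solve-∀)
open import Data.Product using (∃-syntax; _×_; _,_; proj₁; proj₂)
open import Data.Sum using (inj₁; inj₂)
open import Function using (Equivalence)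
open import Relation.Binary.Definitions using (tri<; tri≈; tri>)
open import Relation.Binary.PropositionalEquality using (_≡_; _≢_; refl; sym; trans; cong; cong₂; subst)
open import Relation.Nullary using (¬_; yes; no; does; contradiction; _×-dec_)
open import Relation.Unary using (Pred; Decidable)

-- Least and greatest elements of decidable sets of naturals.

module _ {ℓ} {P : Pred ℕ ℓ} (P? : Decidable P) where

  least-exists : ∀ x → P x → ∃[ y ] IsLeast P y
  least-exists x Px = search 0 x refl λ _ _ → z≤n
    where
    -- The distance `d` left to the witness `x` makes the upward search terminate; everything in `P`
    -- is at least the candidate `s`.
    search : ∀ s d → s + d ≡ x → (∀ y → P y → s ≤ y) → ∃[ y ] IsLeast P y
    search s d eq below with P? s
    ... | yes Ps = s , Ps , below
    search s zero    eq below | no ¬Ps =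
      contradiction (subst P (trans (sym eq) (+-identityʳ s)) Px) ¬Ps
    search s (suc d) eq below | no ¬Ps =
      search (suc s) d (trans (sym (+-suc s d)) eq)
        λ y Py → ≤∧≢⇒< (below y Py) λ where refl → ¬Ps Py

  greatest-exists : ∀ N → (∀ y → P y → y ≤ N) → ∀ x → P x → ∃[ y ] IsGreatest P y
  greatest-exists N above x Px with P? N
  ... | yes PN = N , PN , above
  greatest-exists zero    above x Px | no ¬PN =
    contradiction (subst P (n≤0⇒n≡0 (above x Px)) Px) ¬PN
  greatest-exists (suc N) above x Px | no ¬PN =
    greatest-exists N (λ y Py → s≤s⁻¹ (≤∧≢⇒< (above y Py) λ where refl → ¬PN Py)) x Px

-- Congruences modulo P.

-- The congruences s ≡ d - c, t ≡ d - c modulo P, with explicit quotients.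
module _ {P s t c d : ℕ} (e f : ℕ) (s≡ : s + c ≡ d + e * P) (t≡ : t + c ≡ d + f * P) where

  quotient-≤ : s < t + P → e ≤ f
  quotient-≤ s<t+P = s≤s⁻¹ (*-cancelʳ-< P e (suc f) (+-cancelˡ-< d _ _ (begin-strict
    d + e * P       ≡⟨ s≡ ⟨
    s + c           <⟨ +-monoˡ-< c s<t+P ⟩
    t + P + c       ≡⟨ swap t P c ⟩
    t + c + P       ≡⟨ cong (_+ P) t≡ ⟩
    d + f * P + P   ≡⟨ reassoc d P f ⟩
    d + suc f * P   ∎)))
    where
    open ≤-Reasoning
    swap : ∀ x y z → x + y + z ≡ x + z + y
    swap = solve-∀
    reassoc : ∀ d P f → d + f * P + P ≡ d + suc f * P
    reassoc = solve-∀

  quotient-≡ : e ≡ f → s ≡ t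
  quotient-≡ refl = +-cancelʳ-≡ c s t (trans s≡ (sym t≡))

congruent-close⇒≡ : ∀ {P s t c d} e f → s + c ≡ d + e * P → t + c ≡ d + f * P →
                    s < t + P → t < s + P → s ≡ t
congruent-close⇒≡ {P} e f s≡ t≡ s<t+P t<s+P = quotient-≡ {P} e f s≡ t≡
  (≤-antisym (quotient-≤ e f s≡ t≡ s<t+P) (quotient-≤ f e t≡ s≡ t<s+P))

-- Equality with `k < l` would force `f < e`, so the left side would be at least `k + P + f * P`,
-- which already exceeds the right side.
distinct-residues : ∀ {P k l} e f → k < l → l < k + P → k + e * P ≢ l + f * P
distinct-residues {P} {k} {l} e f k<l l<k+P eq = <-irrefl refl (begin-strict
  l + f * P         <⟨ +-monoˡ-< (f * P) l<k+P ⟩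
  k + P + f * P     ≡⟨ +-assoc k P (f * P) ⟩
  k + suc f * P     ≤⟨ +-monoʳ-≤ k (*-monoˡ-≤ P f<e) ⟩
  k + e * P         ≡⟨ eq ⟩
  l + f * P         ∎)
  where
  open ≤-Reasoning
  f<e : f < e
  f<e = *-cancelʳ-< P f e (+-cancelˡ-< k _ _ (begin-strict
    k + f * P   <⟨ +-monoˡ-< (f * P) k<l ⟩
    l + f * P   ≡⟨ eq ⟨
    k + e * P   ∎))

<⌊/2⌋⇒double< : ∀ {b P} → b < ⌊ P /2⌋ → b + b < P
<⌊/2⌋⇒double< {b} {P} b< = begin-strict
  b + b               <⟨ +-mono-< b< b< ⟩
  ⌊ P /2⌋ + ⌊ P /2⌋   ≤⟨ +-monoʳ-≤ ⌊ P /2⌋ (⌊n/2⌋≤⌈n/2⌉ P) ⟩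
  ⌊ P /2⌋ + ⌈ P /2⌉   ≡⟨ ⌊n/2⌋+⌈n/2⌉≡n P ⟩
  P                   ∎
  where open ≤-Reasoning

-- Rectangles, periodicity, bandwidth and row lengths in A(n).

-- The greedy rule rejects a one only at the corner determined last: the lower row and the larger of
-- the two columns. Hence the split on the order of `j` and `l`.
A-rectangleFree : ∀ n i k j l → 1 ≤ i → 1 ≤ j → 1 ≤ l → i < k → j ≢ l →
  A n i j ≡ 1 → A n i l ≡ 1 → A n k j ≡ 1 → ¬ A n k l ≡ 1
A-rectangleFree n i k j l 1≤i 1≤j 1≤l i<k j≢l ij il kj kl with <-cmp j l
... | tri< j<l _ _ = proj₂ (proj₂ (Equivalence.to (A-one n k l (≤-trans 1≤i (<⇒≤ i<k)) 1≤l) kl))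
                       (i , i<k , 1≤i , j , j<l , 1≤j , ij , il , kj)
... | tri≈ _ j≡l _ = j≢l j≡l
... | tri> _ _ l<j = proj₂ (proj₂ (Equivalence.to (A-one n k j (≤-trans 1≤i (<⇒≤ i<k)) 1≤j) kj))
                       (i , i<k , 1≤i , l , l<j , 1≤l , il , ij , kl)

PeriodicFrom-multiple : ∀ {a q c} → PeriodicFrom a q c → ∀ m → PeriodicFrom a (q * m) c
PeriodicFrom-multiple {a} {q} per zero i j c<i 1≤j = cong₂ a (drop i) (drop j)
  where
  drop : ∀ x → x + q * 0 ≡ x
  drop x = trans (cong (x +_) (*-zeroʳ q)) (+-identityʳ x)
PeriodicFrom-multiple {a} {q} per (suc m) i j c<i 1≤j =
  trans (cong₂ a (split i q m) (split j q m))
    (trans (per (i + q * m) (j + q * m) (m≤n⇒m≤n+o (q * m) c<i) (m≤n⇒m≤n+o (q * m) 1≤j))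
           (PeriodicFrom-multiple {a} per m i j c<i 1≤j))
  where
  split : ∀ x q m → x + q * suc m ≡ x + q * m + q
  split = solve-∀

module _ {a : Matrix} {pp b : ℕ} (bandwidth : IsBandwidth a pp b) where

  private
    band : ∀ {i j} → pp < i → 1 ≤ j → a i j ≡ 1 → ∣ j - i ∣ ≤ b
    band {i} {j} pp<i 1≤j ij =
      proj₂ bandwidth _ (i , j , ≤-trans (s≤s z≤n) pp<i , 1≤j , ij , pp<i , refl)

  column≤row+bandwidth : ∀ {i j} → pp < i → 1 ≤ j → a i j ≡ 1 → j ≤ i + b
  column≤row+bandwidth {i} {j} pp<i 1≤j ij =
    ≤-trans (m≤n+∣m-n∣ j i) (+-monoʳ-≤ i (band pp<i 1≤j ij))

  row≤column+bandwidth : ∀ {i j} → pp < i → 1 ≤ j → a i j ≡ 1 → i ≤ j + b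
  row≤column+bandwidth {i} {j} pp<i 1≤j ij =
    ≤-trans (m≤n+∣n-m∣ i j) (+-monoʳ-≤ j (band pp<i 1≤j ij))

  -- `lmax` applies only once the row's first and last ones `f` and `l` are at hand; the bandwidth
  -- bounds the search for `l`. Then `x ≤ l`, `f ≤ y` and `l ∸ f + 1 ≤ lmax`.
  ones-in-row-close : ∀ {lmax} → IsMaxRowLength a pp lmax →
    ∀ {k x y} → pp < k → 1 ≤ x → 1 ≤ y → a k x ≡ 1 → a k y ≡ 1 → x < y + lmax
  ones-in-row-close {lmax} maxLen {k} {x} {y} pp<k 1≤x 1≤y kx ky
    with least-exists one? x (1≤x , kx)
       | greatest-exists one? (k + b) (λ _ (1≤j , kj) → column≤row+bandwidth pp<k 1≤j kj) x (1≤x , kx)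
    where
    one? : Decidable (λ j → 1 ≤ j × a k j ≡ 1)
    one? j = (1 ≤? j) ×-dec (a k j ≟ 1)
  ... | f , least | l , greatest = begin-strict
    x                 ≤⟨ proj₂ greatest x (1≤x , kx) ⟩
    l                 ≤⟨ m≤n+m∸n l f ⟩
    f + (l ∸ f)       ≤⟨ +-monoˡ-≤ (l ∸ f) (proj₂ least y (1≤y , ky)) ⟩
    y + (l ∸ f)       <⟨ +-monoʳ-< y (m<m+n (l ∸ f) (s≤s z≤n)) ⟩
    y + (l ∸ f + 1)   ≤⟨ +-monoʳ-≤ y (proj₂ maxLen _ (k , pp<k , f , l , least , greatest , refl)) ⟩
    y + lmax          ∎
    where open ≤-Reasoning

-- Lifting ones of B to A(n).

-- A one of a in row v + i whose column x is congruent to v + k modulo P; the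
-- summand P on the left avoids a negative quotient.
LiftedOne : Matrix → (P v i k : ℕ) → Set
LiftedOne a P v i k = ∃[ x ] ∃[ e ] 1 ≤ x × a (v + i) x ≡ 1 × x + P ≡ v + k + e * P

lift-one : ∀ {a P v} i k → P ≤ v → 1 ≤ k → wrap a P v i k ≡ 1 → LiftedOne a P v i k
lift-one {a} {P} {v} i k P≤v 1≤k eq
  with does ((i ≤? k + ⌊ P /2⌋) ×-dec (k ≤? i + ⌊ P /2⌋))
-- The quotients 1, 0, 2 encode column shifts by 0, -P, +P, in line with the extra `P` in
-- `LiftedOne`.
... | true  = v + k , 1 , m≤n⇒m≤o+n v 1≤k , eq , cong (v + k +_) (sym (*-identityˡ P))
... | false with does (i + ⌊ P /2⌋ <? k)
...   | true  = v + k ∸ P , 0 , m<n⇒0<n∸m (≤-<-trans P≤v (m<m+n v 1≤k)) , eq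
              , trans (m∸n+n≡m (m≤n⇒m≤n+o k P≤v)) (sym (+-identityʳ (v + k)))
...   | false = v + k + P , 2 , m≤n⇒m≤n+o P (m≤n⇒m≤o+n v 1≤k) , eq , double (v + k) P
  where
  double : ∀ x P → x + P + P ≡ x + 2 * P
  double = solve-∀

-- No rectangle in B.

module _ (n : ℕ) {pp b lmax P v : ℕ}
         (periodic  : PeriodicFrom (A n) P pp)
         (bandwidth : IsBandwidth (A n) pp b)
         (maxLen    : IsMaxRowLength (A n) pp lmax)
         (2b<P      : b + b < P)
         (2lmax≤P   : 2 * lmax ≤ P)
         (v≥        : pp + P ≤ v)
  where

  no-lifted-rectangle : ∀ {i j k l} → 1 ≤ i → i < j → j < i + P → k < l → l < k + P →
    LiftedOne (A n) P v i k → LiftedOne (A n) P v i l → LiftedOne (A n) P v j k → ¬ LiftedOne (A n) P v j l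
  no-lifted-rectangle {i} {j} {k} {l} 1≤i i<j j<i+P k<l l<k+P
    (x , e , 1≤x , ix , x≡) (x′ , e′ , 1≤x′ , ix′ , x′≡)
    (y , f , 1≤y , jy , y≡) (y′ , f′ , 1≤y′ , jy′ , y′≡)
    = conclude
    where
    open ≤-Reasoning

    pp<v+i : pp < v + i
    pp<v+i = ≤-<-trans (≤-trans (m≤m+n pp P) v≥) (m<m+n v 1≤i)

    pp<v+j : pp < v + j
    pp<v+j = <-trans pp<v+i (+-monoʳ-< v i<j)

    combine : ∀ {z w c d} g h → z + P ≡ c + g * P → w + P ≡ d + h * P →
              z + w + (P + P) ≡ c + d + (g + h) * P
    combine {z} {w} {c} {d} g h z≡ w≡ = trans (left z w P) (trans (cong₂ _+_ z≡ w≡) (right c d g h P))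
      where
      left : ∀ z w P → z + w + (P + P) ≡ (z + P) + (w + P)
      left = solve-∀
      right : ∀ c d g h P → (c + g * P) + (d + h * P) ≡ c + d + (g + h) * P
      right = solve-∀

    close : ∀ {z z′ w w′} → z < z′ + lmax → w′ < w + lmax → z + w′ < z′ + w + P
    close {z} {z′} {w} {w′} z< w′< = begin-strict
      z + w′                     <⟨ +-mono-< z< w′< ⟩
      (z′ + lmax) + (w + lmax)   ≡⟨ regroup z′ w lmax ⟩
      z′ + w + 2 * lmax          ≤⟨ +-monoʳ-≤ (z′ + w) 2lmax≤P ⟩
      z′ + w + P                 ∎
      where
      regroup : ∀ s t u → (s + u) + (t + u) ≡ s + t + 2 * u
      regroup = solve-∀

    -- This is `x - x′ = y - y′` without subtraction. Both sums are congruent to `(v + k) + (v + l)`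
    -- modulo `P`, and they differ by less than `2 * lmax ≤ P`, as each row contributes less than
    -- `lmax`.
    same-distance : x + y′ ≡ x′ + y
    same-distance = congruent-close⇒≡ (e + f′) (e′ + f)
      (combine e f′ x≡ y′≡)
      (trans (combine e′ f x′≡ y≡) (cong (_+ (e′ + f) * P) (+-comm (v + l) (v + k))))
      (close {x} {x′} {y} {y′} (rowClose pp<v+i 1≤x 1≤x′ ix ix′) (rowClose pp<v+j 1≤y′ 1≤y jy′ jy))
      (close {x′} {x} {y′} {y} (rowClose pp<v+i 1≤x′ 1≤x ix′ ix) (rowClose pp<v+j 1≤y 1≤y′ jy jy′))
      where rowClose = ones-in-row-close bandwidth maxLen

    -- Row `v + i` lies above row `v + j`, so by the band `x` exceeds `y` by less than `2b < P`.
    e≤f : e ≤ f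
    e≤f = quotient-≤ e f x≡ y≡ (begin-strict
      x             ≤⟨ column≤row+bandwidth bandwidth pp<v+i 1≤x ix ⟩
      v + i + b     <⟨ +-monoˡ-< b (+-monoʳ-< v i<j) ⟩
      v + j + b     ≤⟨ +-monoˡ-≤ b (row≤column+bandwidth bandwidth pp<v+j 1≤y jy) ⟩
      y + b + b     ≡⟨ +-assoc y b b ⟩
      y + (b + b)   <⟨ +-monoʳ-< y 2b<P ⟩
      y + P         ∎)

    x+P≡ : x + P + P ≡ v + k + suc e * P
    x+P≡ = trans (cong (_+ P) x≡) (reassoc (v + k) e P)
      where
      reassoc : ∀ c e P → c + e * P + P ≡ c + suc e * P
      reassoc = solve-∀

    -- The same band estimate, with the first row moved down by `P` and hence below row `v + j`.
    f≤1+e : f ≤ suc e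
    f≤1+e = quotient-≤ f (suc e) y≡ x+P≡ (begin-strict
      y                   ≤⟨ column≤row+bandwidth bandwidth pp<v+j 1≤y jy ⟩
      v + j + b           <⟨ +-monoˡ-< b (+-monoʳ-< v j<i+P) ⟩
      v + (i + P) + b     ≡⟨ regroup v i P b ⟩
      v + i + (b + P)     ≤⟨ +-monoˡ-≤ (b + P) (row≤column+bandwidth bandwidth pp<v+i 1≤x ix) ⟩
      x + b + (b + P)     ≡⟨ regroup′ x b P ⟩
      x + P + (b + b)     <⟨ +-monoʳ-< (x + P) 2b<P ⟩
      x + P + P           ∎)
      where
      regroup : ∀ v i P b → v + (i + P) + b ≡ v + i + (b + P)
      regroup = solve-∀
      regroup′ : ∀ x b P → x + b + (b + P) ≡ x + P + (b + b)
      regroup′ = solve-∀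

    -- Equal column distances carry a displacement of the first column over to the second.
    shift : ∀ {d} → y ≡ x + d → y′ ≡ x′ + d
    shift {d} refl = +-cancelˡ-≡ x _ _ (trans same-distance (regroup x x′ d))
      where
      regroup : ∀ x x′ d → x′ + (x + d) ≡ x + (x′ + d)
      regroup = solve-∀

    y≢y′ : y ≢ y′
    y≢y′ refl = distinct-residues f f′ k<l l<k+P (+-cancelˡ-≡ v _ _
      (trans (sym (+-assoc v k _)) (trans (sym y≡) (trans y′≡ (+-assoc v l _)))))

    conclude : _
    conclude with m≤n⇒m<n∨m≡n e≤f
    -- Displacement 0: the rectangle already sits in rows `v + i` and `v + j`.
    ... | inj₂ e≡f = A-rectangleFree n (v + i) (v + j) y y′
          (≤-trans (s≤s z≤n) pp<v+i) 1≤y 1≤y′ (+-monoʳ-< v i<j) y≢y′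
          (subst (λ z → A n (v + i) z ≡ 1) x≡y ix)
          (subst (λ z → A n (v + i) z ≡ 1) x′≡y′ ix′) jy jy′
      where
      x≡y : x ≡ y
      x≡y = quotient-≡ {P} e f x≡ y≡ e≡f
      x′≡y′ : x′ ≡ y′
      x′≡y′ = sym (trans (shift (trans (sym x≡y) (sym (+-identityʳ x)))) (+-identityʳ x′))
    -- Displacement `P`: periodicity copies the ones of row `v + i` to row `v + i + P`, which lies
    -- below `v + j`, so `v + j` is now the upper row.
    ... | inj₁ e<f = A-rectangleFree n (v + j) (v + i + P) y y′
          (≤-trans (s≤s z≤n) pp<v+j) 1≤y 1≤y′
          (subst (v + j <_) (sym (+-assoc v i P)) (+-monoʳ-< v j<i+P)) y≢y′ jy jy′
          (subst (λ z → A n (v + i + P) z ≡ 1) (sym y≡x+P) (trans (periodic _ x pp<v+i 1≤x) ix))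
          (subst (λ z → A n (v + i + P) z ≡ 1) (sym (shift y≡x+P)) (trans (periodic _ x′ pp<v+i 1≤x′) ix′))
      where
      y≡x+P : y ≡ x + P
      y≡x+P = quotient-≡ {P} f (suc e) y≡ x+P≡ (≤-antisym f≤1+e e<f)

  B-noRectangle : NoRectangle (B (A n) P v)
  B-noRectangle (i , j , k , l , i<j , k<l , ik , il , jk , jl) =
    no-lifted-rectangle (s≤s z≤n) (s≤s i<j) (within i j) (s≤s k<l) (within k l)
      (lift i k ik) (lift i l il) (lift j k jk) (lift j l jl)
    where
    within : ∀ (s t : Fin P) → suc (toℕ t) < suc (toℕ s) + P
    within s t = s≤s (≤-trans (toℕ<n t) (m≤n+m P (toℕ s)))
    lift : ∀ (s t : Fin P) → B (A n) P v s t ≡ 1 → LiftedOne (A n) P v (suc (toℕ s)) (suc (toℕ t))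
    lift s t = lift-one {A n} (suc (toℕ s)) (suc (toℕ t)) (≤-trans (m≤n+m P pp) v≥) (s≤s z≤n)

-- From rectangles to the incidence structure.

-- Two distinct lines through two distinct points form a rectangle once both pairs are sorted, which
-- gives the four cases.
noRectangle⇒linesMeetAtMostOnce : ∀ {s} (b : Fin s → Fin s → ℕ) →
  NoRectangle b → LinesMeetAtMostOnce (incidenceStructure b)
noRectangle⇒linesMeetAtMostOnce b noRect g h g≢h x y gx hx gy hy
  with <-cmp (toℕ g) (toℕ h) | <-cmp (toℕ x) (toℕ y)
... | _            | tri≈ _ x≡y _ = toℕ-injective x≡y
... | tri≈ _ g≡h _ | _            = contradiction (toℕ-injective g≡h) g≢h
... | tri< g<h _ _ | tri< x<y _ _ = contradiction (g , h , x , y , g<h , x<y , gx , gy , hx , hy) noRect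
... | tri< g<h _ _ | tri> _ _ y<x = contradiction (g , h , y , x , g<h , y<x , gy , gx , hy , hx) noRect
... | tri> _ _ h<g | tri< x<y _ _ = contradiction (h , g , x , y , h<g , x<y , hx , hy , gx , gy) noRect
... | tri> _ _ h<g | tri> _ _ y<x = contradiction (h , g , y , x , h<g , y<x , hy , hx , gy , gx) noRect

theorem4p4 : ∀ (n : ℕ) → n ≥ 1 →
    ∀ (p pp b lmax : ℕ) →
    IsPeriod (A n) p →
    IsPreperiod (A n) p pp →
    IsBandwidth (A n) pp b →
    IsMaxRowLength (A n) pp lmax →
    ∀ (m : ℕ) → m ≥ 1 →
    ⌊ p * m /2⌋ > b →
    p * m ≥ 2 * lmax →
    ∀ (v : ℕ) → v ≥ pp + p * m →
    LinesMeetAtMostOnce (incidenceStructure (B (A n) (p * m) v))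
    × NoRectangle (B (A n) (p * m) v)
theorem4p4 n _ p pp b lmax _ preperiod bandwidth maxLen m _ r>b 2lmax≤p̄ v v≥ =
  noRectangle⇒linesMeetAtMostOnce _ noRect , noRect
  where
  noRect : NoRectangle (B (A n) (p * m) v)
  noRect = B-noRectangle n (PeriodicFrom-multiple {A n} (proj₁ preperiod) m) bandwidth maxLen
             (<⌊/2⌋⇒double< r>b) 2lmax≤p̄ v≥
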